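{- The class of integral involutive near semirings is a Church variety, as witnessed by the term $$q(x,y,z)=(x\cdot y)+(\alpha(x)\cdot z)$$ and the constants $0,1$.
   Context: A near semiring is an algebra $\langle R,+,\cdot,0,1\rangle$ such that: (i) $\langle R,+,0\rangle$ is a commutative monoid; (ii) $x\cdot 1=x=1\cdot x$ (multiplication need not be associative or commutative); (iii) $(x+y)\cdot z=(x\cdot z)+(y\cdot z)$; (iv) $x\cdot 0=0\cdot x=0$. It is idempotent if $x+x=x$; then $x\le y$ iff $x+y=y$ defines a partial order, called the induced order. It is integral if $x+1=1$ for all $x$. An involutive near semiring is an idempotent near semiring with a map $\alpha:R\to R$ such that $\alpha(\alpha(x))=x$, and $x\le y$ implies $\alpha(y)\le\alpha(x)$; it is regarded as an algebra $\langle R,+,\cdot,0,1,\alpha\rangle$. An algebra $\mathbf{A}$ is a Church algebra if there are term definable elements $0^{\mathbf{A}},1^{\mathbf{A}}\in A$ and a ternary term operation $q^{\mathbf{A}}$ such that $q^{\mathbf{A}}(1^{\mathbf{A}},a,b)=a$ and $q^{\mathbf{A}}(0^{\mathbf{A}},a,b)=b$ for all $a,b\in A$. A variety (equationally definable class of algebras of a fixed type) is a Church variety if every member is a Church algebra with respect to the same term $q$ and the same constants $0,1$. -}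

module Defs where

open import Level using (Level; _⊔_; suc; 0ℓ)
open import Algebra.Core using (Op₁; Op₂)
import Algebra.Definitions as AlgebraDefinitions
import Algebra.Structures as AlgebraStructures
open import Data.Fin.Base using (Fin)
open import Data.Nat.Base using (ℕ)
open import Data.Product.Base using (_×_; _,_; ∃)
open import Data.Vec.Base using (Vec; []; _∷_; lookup)
open import Data.Vec.Relation.Binary.Pointwise.Inductive using (Pointwise)
open import Function.Bundles using (_⇔_)
open import Relation.Binary.Bundles using (Setoid)
open import Relation.Binary.Core using (Rel)
open import Relation.Binary.Definitions using (Antitonic₁)
open import Relation.Unary using (Pred; _∈_)

------------------------------------------------------------------------
-- Universal algebra

record Signature : Set₁ where
  field
    Symbol : Set
    arity  : Symbol → ℕ

record Algebra (𝓢 : Signature) (c ℓ : Level) : Set (suc (c ⊔ ℓ)) where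
  open Signature 𝓢
  field
    setoid : Setoid c ℓ

  open Setoid setoid public

  field
    interp      : (f : Symbol) → Vec Carrier (arity f) → Carrier
    interp-cong : (f : Symbol) {xs ys : Vec Carrier (arity f)} →
                  Pointwise _≈_ xs ys → interp f xs ≈ interp f ys

data Term (𝓢 : Signature) (X : Set) : Set where
  var : X → Term 𝓢 X
  op  : (f : Signature.Symbol 𝓢) →
        Vec (Term 𝓢 X) (Signature.arity 𝓢 f) → Term 𝓢 X

module _ {𝓢 : Signature} {c ℓ : Level} (𝐀 : Algebra 𝓢 c ℓ) where
  open Algebra 𝐀

  mutual
    eval : {X : Set} → Term 𝓢 X → (X → Carrier) → Carrier
    eval (var x)   ρ = ρ x
    eval (op f ts) ρ = interp f (evals ts ρ)

    evals : {X : Set} {n : ℕ} →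
            Vec (Term 𝓢 X) n → (X → Carrier) → Vec Carrier n
    evals []       ρ = []
    evals (t ∷ ts) ρ = eval t ρ ∷ evals ts ρ

  termOp : {n : ℕ} → Term 𝓢 (Fin n) → Vec Carrier n → Carrier
  termOp t xs = eval t (lookup xs)

Equation : Signature → Set
Equation 𝓢 = Term 𝓢 ℕ × Term 𝓢 ℕ

infix 4 _⊨_

_⊨_ : {𝓢 : Signature} {c ℓ : Level} →
      Algebra 𝓢 c ℓ → Pred (Equation 𝓢) 0ℓ → Set (c ⊔ ℓ)
_⊨_ {𝓢} 𝐀 E = {s t : Term 𝓢 ℕ} → (s , t) ∈ E →
               (ρ : ℕ → Carrier) → eval 𝐀 s ρ ≈ eval 𝐀 t ρ
  where open Algebra 𝐀

IsVariety : {𝓢 : Signature} {c ℓ k : Level} →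
            Pred (Algebra 𝓢 c ℓ) k → Set (suc (c ⊔ ℓ) ⊔ k)
IsVariety {𝓢} {c} {ℓ} 𝓚 =
  ∃ λ (E : Pred (Equation 𝓢) 0ℓ) →
    (𝐀 : Algebra 𝓢 c ℓ) → 𝐀 ∈ 𝓚 ⇔ 𝐀 ⊨ E

------------------------------------------------------------------------
-- Church algebras and Church varieties

-- The witnessing terms are parameters: `0ᵗ` and `1ᵗ` are closed terms and
-- `q` is a term in three variables.  Being a Church algebra outright means
-- that such terms exist.

record IsChurchAlgebraVia {𝓢 : Signature} {c ℓ : Level}
         (0ᵗ 1ᵗ : Term 𝓢 (Fin 0)) (q : Term 𝓢 (Fin 3))
         (𝐀 : Algebra 𝓢 c ℓ) : Set (c ⊔ ℓ) where
  open Algebra 𝐀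
  field
    q-1 : (a b : Carrier) →
          termOp 𝐀 q (termOp 𝐀 1ᵗ [] ∷ a ∷ b ∷ []) ≈ a
    q-0 : (a b : Carrier) →
          termOp 𝐀 q (termOp 𝐀 0ᵗ [] ∷ a ∷ b ∷ []) ≈ b

record IsChurchVarietyVia {𝓢 : Signature} {c ℓ k : Level}
         (0ᵗ 1ᵗ : Term 𝓢 (Fin 0)) (q : Term 𝓢 (Fin 3))
         (𝓚 : Pred (Algebra 𝓢 c ℓ) k) : Set (suc (c ⊔ ℓ) ⊔ k) where
  field
    isVariety : IsVariety 𝓚
    isChurch  : (𝐀 : Algebra 𝓢 c ℓ) → 𝐀 ∈ 𝓚 →
                IsChurchAlgebraVia 0ᵗ 1ᵗ q 𝐀

------------------------------------------------------------------------
-- Near semirings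

module _ {a ℓ : Level} {A : Set a} (_≈_ : Rel A ℓ) where
  open AlgebraDefinitions _≈_
  open AlgebraStructures _≈_ using (IsCommutativeMonoid; IsUnitalMagma)

  -- Unlike in `Algebra.Structures.IsNearSemiring`, addition is commutative,
  -- multiplication has a unit and need not be associative, and 0# annihilates
  -- on both sides.
  record IsNearSemiring (_+_ _*_ : Op₂ A) (0# 1# : A) : Set (a ⊔ ℓ) where
    field
      +-isCommutativeMonoid : IsCommutativeMonoid _+_ 0#
      *-isUnitalMagma       : IsUnitalMagma _*_ 1#
      distribʳ              : _*_ DistributesOverʳ _+_
      zero                  : Zero 0# _*_

  InducedOrder : Op₂ A → Rel A ℓ
  InducedOrder _+_ x y = (x + y) ≈ y

  record IsInvolutiveNearSemiring
           (_+_ _*_ : Op₂ A) (0# 1# : A) (α : Op₁ A) : Set (a ⊔ ℓ) where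
    field
      isNearSemiring : IsNearSemiring _+_ _*_ 0# 1#
      +-idem         : Idempotent _+_
      α-cong         : Congruent₁ α
      α-involutive   : Involutive α
      α-antitone     : Antitonic₁ (InducedOrder _+_) (InducedOrder _+_) α

  record IsIntegralInvolutiveNearSemiring
           (_+_ _*_ : Op₂ A) (0# 1# : A) (α : Op₁ A) : Set (a ⊔ ℓ) where
    field
      isInvolutiveNearSemiring : IsInvolutiveNearSemiring _+_ _*_ 0# 1# α
      integral                 : RightZero 1# _+_

------------------------------------------------------------------------
-- Integral involutive near semirings as a class of algebras

data InvSymbol : Set where
  +ˢ ·ˢ 0ˢ 1ˢ αˢ : InvSymbol

invArity : InvSymbol → ℕ
invArity +ˢ = 2
invArity ·ˢ = 2
invArity 0ˢ = 0
invArity 1ˢ = 0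
invArity αˢ = 1

invSignature : Signature
invSignature = record { Symbol = InvSymbol ; arity = invArity }

IntegralInvolutiveNearSemirings :
  {c ℓ : Level} → Pred (Algebra invSignature c ℓ) (c ⊔ ℓ)
IntegralInvolutiveNearSemirings 𝐀 =
  IsIntegralInvolutiveNearSemiring _≈_
    (λ x y → interp +ˢ (x ∷ y ∷ []))
    (λ x y → interp ·ˢ (x ∷ y ∷ []))
    (interp 0ˢ [])
    (interp 1ˢ [])
    (λ x → interp αˢ (x ∷ []))
  where open Algebra 𝐀

module _ {X : Set} where
  infixl 6 _⊕_
  infixl 7 _⊙_

  _⊕_ _⊙_ : Op₂ (Term invSignature X)
  s ⊕ t = op +ˢ (s ∷ t ∷ [])
  s ⊙ t = op ·ˢ (s ∷ t ∷ [])

  `0 `1 : Term invSignature X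
  `0 = op 0ˢ []
  `1 = op 1ˢ []

  `α : Op₁ (Term invSignature X)
  `α t = op αˢ (t ∷ [])

q : Term invSignature (Fin 3)
q = (x ⊙ y) ⊕ (`α x ⊙ z)
  where
  x y z : Term invSignature (Fin 3)
  x = var Fin.zero
  y = var (Fin.suc Fin.zero)
  z = var (Fin.suc (Fin.suc Fin.zero))

{-# OPTIONS --safe #-}

-- Every axiom is an equation except antitonicity of α, which is equivalent to
-- α (x + y) + α x ≈ α x.  For the Church equations, 0 is the least and 1 the
-- greatest element, and α is an order-reversing involution, so α 0 ≈ 1 and
-- α 1 ≈ 0.
module Submission where

open import Defs

open import Algebra.Definitions using (Congruent₁; Congruent₂)
open import Algebra.Structures using (IsCommutativeMonoid; IsUnitalMagma)
open import Data.Nat.Base using (ℕ; zero; suc)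
open import Data.Product.Base using (_,_; proj₁; proj₂)
open import Data.Vec.Base using ([]; _∷_)
open import Data.Vec.Relation.Binary.Pointwise.Inductive using ([]; _∷_)
open import Level using (Level; 0ℓ)
open import Relation.Binary.Definitions using (Antitonic₁)
open import Relation.Binary.PropositionalEquality.Core using (cong)
import Relation.Binary.Reasoning.Setoid as SetoidReasoning
open import Relation.Unary using (Pred; _∈_)

private
  variable
    c ℓ : Level

  x y z : Term invSignature ℕ
  x = var 0
  y = var 1
  z = var 2

-- In `*-distribʳ-+` the right factor is `x`, matching the argument order of the library's
-- `DistributesOverʳ`, so that assigning the arguments to variables 0, 1, 2 in order instantiates
-- it.
data Axiom : Pred (Equation invSignature) 0ℓ where
  +-assoc      : Axiom ((x ⊕ y) ⊕ z , x ⊕ (y ⊕ z))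
  +-comm       : Axiom (x ⊕ y , y ⊕ x)
  +-identityˡ  : Axiom (`0 ⊕ x , x)
  +-idem       : Axiom (x ⊕ x , x)
  *-identityˡ  : Axiom (`1 ⊙ x , x)
  *-identityʳ  : Axiom (x ⊙ `1 , x)
  *-distribʳ-+ : Axiom ((y ⊕ z) ⊙ x , (y ⊙ x) ⊕ (z ⊙ x))
  *-zeroˡ      : Axiom (`0 ⊙ x , `0)
  *-zeroʳ      : Axiom (x ⊙ `0 , `0)
  α-involutive : Axiom (`α (`α x) , x)
  α-antitone   : Axiom (`α (x ⊕ y) ⊕ `α x , `α x)
  +-zeroʳ      : Axiom (x ⊕ `1 , `1)

module _ (𝐀 : Algebra invSignature c ℓ) where
  open Algebra 𝐀
  open SetoidReasoning setoid

  private
    infixl 6 _+_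
    infixl 7 _*_

    _+_ _*_ : Carrier → Carrier → Carrier
    a + b = interp +ˢ (a ∷ b ∷ [])
    a * b = interp ·ˢ (a ∷ b ∷ [])

    0# 1# : Carrier
    0# = interp 0ˢ []
    1# = interp 1ˢ []

    α : Carrier → Carrier
    α a = interp αˢ (a ∷ [])

    +-cong : Congruent₂ _≈_ _+_
    +-cong p r = interp-cong +ˢ (p ∷ r ∷ [])

    *-cong : Congruent₂ _≈_ _*_
    *-cong p r = interp-cong ·ˢ (p ∷ r ∷ [])

    α-cong : Congruent₁ _≈_ α
    α-cong p = interp-cong αˢ (p ∷ [])

  module _ (𝐀∈𝓚 : 𝐀 ∈ IntegralInvolutiveNearSemirings) where
    private
      open IsIntegralInvolutiveNearSemiring 𝐀∈𝓚
        using (isInvolutiveNearSemiring; integral)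
      module V = IsInvolutiveNearSemiring isInvolutiveNearSemiring
      module N = IsNearSemiring V.isNearSemiring
      module + = IsCommutativeMonoid N.+-isCommutativeMonoid
      module * = IsUnitalMagma N.*-isUnitalMagma

    ∈𝓚⇒⊨ : 𝐀 ⊨ Axiom
    ∈𝓚⇒⊨ +-assoc      ρ = +.assoc _ _ _
    ∈𝓚⇒⊨ +-comm       ρ = +.comm _ _
    ∈𝓚⇒⊨ +-identityˡ  ρ = +.identityˡ _
    ∈𝓚⇒⊨ +-idem       ρ = V.+-idem _
    ∈𝓚⇒⊨ *-identityˡ  ρ = *.identityˡ _
    ∈𝓚⇒⊨ *-identityʳ  ρ = *.identityʳ _
    ∈𝓚⇒⊨ *-distribʳ-+ ρ = N.distribʳ _ _ _
    ∈𝓚⇒⊨ *-zeroˡ      ρ = proj₁ N.zero _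
    ∈𝓚⇒⊨ *-zeroʳ      ρ = proj₂ N.zero _
    ∈𝓚⇒⊨ α-involutive ρ = V.α-involutive _
    ∈𝓚⇒⊨ +-zeroʳ      ρ = integral _
    -- Antitonicity is applied to a ≤ a + b, which follows from associativity and idempotence.
    ∈𝓚⇒⊨ α-antitone   ρ = V.α-antitone (begin
      a + (a + b)  ≈⟨ +.assoc a a b ⟨
      (a + a) + b  ≈⟨ +-cong (V.+-idem a) refl ⟩
      a + b        ∎)
      where
      a = ρ 0
      b = ρ 1

    -- Since 0 ≤ α 1, antitonicity and involution give 1 ≤ α 0; integrality supplies α 0 ≤ 1.
    α0≈1 : α 0# ≈ 1#
    α0≈1 = begin
      α 0#             ≈⟨ V.α-antitone (+.identityˡ (α 1#)) ⟨
      α (α 1#) + α 0#  ≈⟨ +-cong (V.α-involutive 1#) refl ⟩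
      1# + α 0#        ≈⟨ +.comm 1# (α 0#) ⟩
      α 0# + 1#        ≈⟨ integral (α 0#) ⟩
      1#               ∎

    α1≈0 : α 1# ≈ 0#
    α1≈0 = trans (α-cong (sym α0≈1)) (V.α-involutive 0#)

    -- Evaluating `q` unfolds definitionally to a sum of two products. The values of α at the
    -- constants make one coefficient 1 and the other 0, so the unit law keeps one argument and left
    -- annihilation removes the other.
    ∈𝓚⇒isChurch : IsChurchAlgebraVia `0 `1 q 𝐀
    ∈𝓚⇒isChurch = record
      { q-1 = λ a b → begin
          1# * a + α 1# * b  ≈⟨ +-cong (*.identityˡ a) (*-cong α1≈0 refl) ⟩
          a + 0# * b         ≈⟨ +-cong refl (proj₁ N.zero b) ⟩
          a + 0#             ≈⟨ +.identityʳ a ⟩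
          a                  ∎
      ; q-0 = λ a b → begin
          0# * a + α 0# * b  ≈⟨ +-cong (proj₁ N.zero a) (*-cong α0≈1 refl) ⟩
          0# + 1# * b        ≈⟨ +.identityˡ (1# * b) ⟩
          1# * b             ≈⟨ *.identityˡ b ⟩
          b                  ∎
      }

  module _ (𝐀⊨ : 𝐀 ⊨ Axiom) where
    private
      -- The axioms mention only variables 0, 1 and 2, so the value `d` on all later variables is a
      -- mere default. For equations in two variables `b` is repeated as filler.
      env : Carrier → Carrier → Carrier → ℕ → Carrier
      env a b d zero          = a
      env a b d (suc zero)    = b
      env a b d (suc (suc _)) = d

      env₁ : Carrier → ℕ → Carrier
      env₁ a _ = a

      comm : ∀ a b → a + b ≈ b + a
      comm a b = 𝐀⊨ +-comm (env a b b)

      identityˡ : ∀ a → 0# + a ≈ a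
      identityˡ a = 𝐀⊨ +-identityˡ (env₁ a)

    -- If a ≤ b then b is itself a sum a + b, so the equational form of antitonicity speaks about α
    -- b.
    ⊨⇒α-antitone : Antitonic₁ (InducedOrder _≈_ _+_) (InducedOrder _≈_ _+_) α
    -- `Antitonic₁` flips the relation in its premise, so the larger element is the first implicit
    -- argument.
    ⊨⇒α-antitone {b} {a} a+b≈b = begin
      α b + α a        ≈⟨ +-cong (α-cong a+b≈b) refl ⟨
      α (a + b) + α a  ≈⟨ 𝐀⊨ α-antitone (env a b b) ⟩
      α a              ∎

    ⊨⇒∈𝓚 : 𝐀 ∈ IntegralInvolutiveNearSemirings
    ⊨⇒∈𝓚 = record
      { isInvolutiveNearSemiring = record
        { isNearSemiring = record
          { +-isCommutativeMonoid = record
            { isMonoid = record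
              { isSemigroup = record
                { isMagma = record { isEquivalence = isEquivalence ; ∙-cong = +-cong }
                ; assoc   = λ a b d → 𝐀⊨ +-assoc (env a b d)
                }
              ; identity = identityˡ , λ a → trans (comm a 0#) (identityˡ a)
              }
            ; comm = comm
            }
          ; *-isUnitalMagma = record
            { isMagma  = record { isEquivalence = isEquivalence ; ∙-cong = *-cong }
            ; identity = (λ a → 𝐀⊨ *-identityˡ (env₁ a))
                       , (λ a → 𝐀⊨ *-identityʳ (env₁ a))
            }
          ; distribʳ = λ a b d → 𝐀⊨ *-distribʳ-+ (env a b d)
          ; zero     = (λ a → 𝐀⊨ *-zeroˡ (env₁ a)) , (λ a → 𝐀⊨ *-zeroʳ (env₁ a))
          }
        ; +-idem       = λ a → 𝐀⊨ +-idem (env₁ a)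
        ; α-cong       = α-cong
        ; α-involutive = λ a → 𝐀⊨ α-involutive (env₁ a)
        ; α-antitone   = ⊨⇒α-antitone
        }
      ; integral = λ a → 𝐀⊨ +-zeroʳ (env₁ a)
      }

proposition1 : ∀ {c ℓ} →
    IsChurchVarietyVia `0 `1 q (IntegralInvolutiveNearSemirings {c} {ℓ})
proposition1 = record
  { isVariety = Axiom , λ 𝐀 → record
    { to        = ∈𝓚⇒⊨ 𝐀
    ; from      = ⊨⇒∈𝓚 𝐀
    -- The congruence fields of `_⇔_` concern propositional equality, which every function respects.
    ; to-cong   = cong (∈𝓚⇒⊨ 𝐀)
    ; from-cong = cong (⊨⇒∈𝓚 𝐀)
    }
  ; isChurch  = ∈𝓚⇒isChurch
  }
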